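{- There is no blocking semioval with exactly 25 points in $PG(2,11)$.
   Context: $PG(2,11)$ is the Desarguesian projective plane over the field with 11 elements. A semioval in a projective plane is a set of points $S$ such that at each point of $S$ there is exactly one tangent line, i.e. exactly one line meeting $S$ in exactly one point. A blocking set is a set of points $S$ such that every line meets $S$ in at least one point but $S$ contains no line. A blocking semioval is a set of points that is both a blocking set and a semioval. -}

module Defs where

open import Data.Nat using (ℕ; _+_; _*_; _%_; _≡ᵇ_; _≥_)
open import Data.Fin using (Fin; toℕ)
open import Data.Fin.Base using ()
open import Data.Bool using (Bool; true; false; _∧_; T)
open import Data.List using (List; []; _∷_; map; concatMap; filter; length; allFin)
open import Data.Product using (_×_; _,_; ∃-syntax)
open import Relation.Binary.PropositionalEquality using (_≡_)
open import Relation.Nullary using (¬_)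

-- The field GF(11) is ℤ/11ℤ; elements are represented by Fin 11 and
-- arithmetic is done in ℕ modulo 11.

-- Points of PG(2,11): one-dimensional subspaces of GF(11)^3, represented by
-- their unique normalised homogeneous coordinates:
--   (1,a,b), (0,1,a), (0,0,1).
data Point : Set where
  pt₁ : Fin 11 → Fin 11 → Point
  pt₂ : Fin 11 → Point
  pt₃ : Point

-- Lines of PG(2,11): two-dimensional subspaces, i.e. kernels of nonzero
-- linear forms [u0,u1,u2] up to scalars; same normalisation.
data Line : Set where
  ln₁ : Fin 11 → Fin 11 → Line
  ln₂ : Fin 11 → Line
  ln₃ : Line

Coords : Set
Coords = ℕ × ℕ × ℕ

pcoords : Point → Coords
pcoords (pt₁ a b) = 1 , toℕ a , toℕ b
pcoords (pt₂ a)   = 0 , 1 , toℕ a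
pcoords pt₃       = 0 , 0 , 1

lcoords : Line → Coords
lcoords (ln₁ a b) = 1 , toℕ a , toℕ b
lcoords (ln₂ a)   = 0 , 1 , toℕ a
lcoords ln₃       = 0 , 0 , 1

incident : Point → Line → Bool
incident P L with pcoords P | lcoords L
... | (x₀ , x₁ , x₂) | (u₀ , u₁ , u₂) = ((x₀ * u₀ + x₁ * u₁ + x₂ * u₂) % 11) ≡ᵇ 0

allPoints : List Point
allPoints =
  concatMap (λ a → map (pt₁ a) (allFin 11)) (allFin 11)
  Data.List.++ (map pt₂ (allFin 11) Data.List.++ (pt₃ ∷ []))

PointSet : Set
PointSet = Point → Bool

card : PointSet → ℕ
card S = length (filter (λ P → Data.Bool._≟_ (S P) true) allPoints)

meets : PointSet → Line → ℕ
meets S L = length (filter (λ P → Data.Bool._≟_ (S P ∧ incident P L) true) allPoints)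

IsTangentAt : PointSet → Point → Line → Set
IsTangentAt S P L = (S P ≡ true) × (incident P L ≡ true) × (meets S L ≡ 1)

IsSemioval : PointSet → Set
IsSemioval S = ∀ P → S P ≡ true →
  (∃[ L ] IsTangentAt S P L) × (∀ L L′ → IsTangentAt S P L → IsTangentAt S P L′ → L ≡ L′)

IsBlockingSet : PointSet → Set
IsBlockingSet S =
  (∀ L → meets S L ≥ 1) ×
  (∀ L → ¬ (∀ P → incident P L ≡ true → S P ≡ true))

IsBlockingSemioval : PointSet → Set
IsBlockingSemioval S = IsBlockingSet S × IsSemioval S

{-# OPTIONS --safe #-}
-- Write k(L) for the number of points of S on a line L and t(Q) for the number
-- of tangents through a point Q.  Counting along the pencils and along the
-- tangents, a point Q ∉ S of L lies on at least k(L) − 3 tangents, while exactly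
-- 25 − k(L) tangents meet a non-tangent L outside S; this excludes
-- 7 ≤ k(L) ≤ 9, and k(L) = 11.
--
-- If k(ℓ) = 10, the 15 points off ℓ block every line but ℓ and the ten tangents
-- at points of ℓ, and five further points off ℓ block these in pairs.  But 20
-- points blocking all lines except ℓ also block ℓ (Jamison, Brouwer–Schrijver):
-- the product of their 20 linear forms has degree 20 < 3 · 10, so that its sum
-- over all lines vanishes modulo 11.
--
-- So 1 ≤ k ≤ 6.  With xᵢ the number of i-secants, the standard equations give
-- x₄ + 3x₅ + 6x₆ = 74 and x₃ + x₄ + 15 = 2x₆.  A 4-secant meets each 6-secant in
-- S, and each of its points of S is on at most two 6-secants.  Hence x₄ > 0
-- implies x₆ ≤ 8 and so x₄ ≤ 1, whereas x₄ ≡ 2 modulo 3.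
module Submission where

open import Defs
open import Data.Bool using (Bool; true; false; _∧_; not; T)
open import Data.Bool.Properties using (T?; T-∧; T-≡)
open import Data.Empty using (⊥; ⊥-elim)
import Data.Fin.Properties as Fin
open import Data.List using (List; []; _∷_; _++_; map; concatMap; allFin; upTo; length; filter; filterᵇ)
open import Data.List.Membership.Propositional using (_∈_; lose)
open import Data.List.Membership.Propositional.Properties
  using (∈-filter⁺; ∈-filter⁻; ∈-++⁺ˡ; ∈-++⁺ʳ; ∈-map⁺; ∈-concatMap⁺; ∈-allFin; ∈-upTo⁺)
open import Data.List.Properties using (length-++)
open import Data.List.Relation.Unary.All as All using (All; []; _∷_)
import Data.List.Relation.Unary.All.Properties as All
open import Data.List.Relation.Unary.Any using (Any; here; there)
import Data.List.Relation.Unary.Any.Properties as Any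
open import Data.Nat
open import Data.Nat.Divisibility
  using (_∣_; _∣?_; divides; _∣0; ∣m∣n⇒∣m+n; ∣m+n∣m⇒∣n; ∣n⇒∣m*n; ∣m⇒∣m*n; m%n≡0⇒n∣m; n∣m⇒m%n≡0)
open import Data.Nat.ListAction using (product)
open import Data.Nat.Primality using (Prime; prime?; euclidsLemma)
open import Data.Nat.Properties
open import Data.Nat.Solver using (module +-*-Solver)
open import Data.Product using (_×_; _,_; ∃-syntax; proj₁; proj₂)
open import Data.Sum using (_⊎_; inj₁; inj₂; [_,_]′)
open import Function using (_∘_; id; Equivalence)
open import Relation.Binary.Definitions using (DecidableEquality)
open import Relation.Binary.PropositionalEquality hiding ([_])
open import Relation.Nullary using (¬_; Dec; yes; no; does; contradiction)
open import Relation.Nullary.Decidable using (from-no; from-yes; toWitness; map′; _×-dec_)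
open import Relation.Unary using (Pred; Decidable)

-- Indicators and finite sums of natural numbers.

𝟙 : Bool → ℕ
𝟙 true  = 1
𝟙 false = 0

𝟙≤1 : ∀ b → 𝟙 b ≤ 1
𝟙≤1 true  = s≤s z≤n
𝟙≤1 false = z≤n

𝟙-idem : ∀ b → 𝟙 b * 𝟙 b ≡ 𝟙 b
𝟙-idem true  = refl
𝟙-idem false = refl

𝟙-∧ : ∀ b c → 𝟙 (b ∧ c) ≡ 𝟙 c * 𝟙 b
𝟙-∧ true  true  = refl
𝟙-∧ true  false = refl
𝟙-∧ false true  = refl
𝟙-∧ false false = refl

𝟙-pos : ∀ b → 1 ≤ 𝟙 b → b ≡ true
𝟙-pos true _ = refl

*-pos : ∀ m n → 1 ≤ m * n → 1 ≤ m × 1 ≤ n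
*-pos (suc m) (suc n) _ = s≤s z≤n , s≤s z≤n
*-pos (suc m) zero    p rewrite *-zeroʳ m = contradiction p λ ()

∑ : ∀ {a} {A : Set a} → List A → (A → ℕ) → ℕ
∑ []       f = 0
∑ (x ∷ xs) f = f x + ∑ xs f

module _ {a} {A : Set a} where

  ∑-mono : ∀ xs {f g : A → ℕ} → (∀ x → f x ≤ g x) → ∑ xs f ≤ ∑ xs g
  ∑-mono []       f≤g = z≤n
  ∑-mono (x ∷ xs) f≤g = +-mono-≤ (f≤g x) (∑-mono xs f≤g)

  ∑-cong : ∀ xs {f g : A → ℕ} → (∀ x → f x ≡ g x) → ∑ xs f ≡ ∑ xs g
  ∑-cong []       f≡g = refl
  ∑-cong (x ∷ xs) f≡g = cong₂ _+_ (f≡g x) (∑-cong xs f≡g)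

  ∑-+ : ∀ xs (f g : A → ℕ) → ∑ xs (λ x → f x + g x) ≡ ∑ xs f + ∑ xs g
  ∑-+ []       f g = refl
  ∑-+ (x ∷ xs) f g rewrite ∑-+ xs f g =
    solve 4 (λ a b c d → (a :+ b) :+ (c :+ d) := (a :+ c) :+ (b :+ d)) refl
      (f x) (g x) (∑ xs f) (∑ xs g)
    where open +-*-Solver

  ∑-*ˡ : ∀ xs c (f : A → ℕ) → ∑ xs (λ x → c * f x) ≡ c * ∑ xs f
  ∑-*ˡ []       c f = sym (*-zeroʳ c)
  ∑-*ˡ (x ∷ xs) c f rewrite ∑-*ˡ xs c f = sym (*-distribˡ-+ c (f x) (∑ xs f))

  ∑-*ʳ : ∀ xs c (f : A → ℕ) → ∑ xs (λ x → f x * c) ≡ ∑ xs f * c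
  ∑-*ʳ xs c f = trans (∑-cong xs λ x → *-comm (f x) c) (trans (∑-*ˡ xs c f) (*-comm c _))

  ∑-pos : ∀ xs (f : A → ℕ) → 1 ≤ ∑ xs f → ∃[ x ] x ∈ xs × 1 ≤ f x
  ∑-pos (x ∷ xs) f p with f x in eq
  ... | suc _ = x , here refl , subst (1 ≤_) (sym eq) (s≤s z≤n)
  ... | zero  = let y , y∈xs , q = ∑-pos xs f p in y , there y∈xs , q

  ∑-filter : ∀ {p} {P : Pred A p} (P? : Decidable P) xs (f : A → ℕ) →
             ∑ (filter P? xs) f ≡ ∑ xs (λ x → 𝟙 (does (P? x)) * f x)
  ∑-filter P? []       f = refl
  ∑-filter P? (x ∷ xs) f with does (P? x)
  ... | true  = cong₂ _+_ (sym (+-identityʳ (f x))) (∑-filter P? xs f)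
  ... | false = ∑-filter P? xs f

  length-filter≡∑ : ∀ {p} {P : Pred A p} (P? : Decidable P) xs →
                    length (filter P? xs) ≡ ∑ xs (λ x → 𝟙 (does (P? x)))
  length-filter≡∑ P? []       = refl
  length-filter≡∑ P? (x ∷ xs) with does (P? x)
  ... | true  = cong suc (length-filter≡∑ P? xs)
  ... | false = length-filter≡∑ P? xs

∑-swap : ∀ {a b} {A : Set a} {B : Set b} (xs : List A) (ys : List B) (f : A → B → ℕ) →
         ∑ xs (λ x → ∑ ys (f x)) ≡ ∑ ys (λ y → ∑ xs λ x → f x y)
∑-swap []       []       f = refl
∑-swap []       (y ∷ ys) f = ∑-swap [] ys f
∑-swap (x ∷ xs) ys       f rewrite ∑-swap xs ys f = sym (∑-+ ys (f x) (λ y → ∑ xs λ z → f z y))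

-- Finite types and sums over them.

record Enumeration (A : Set) : Set where
  field
    _≟′_     : DecidableEquality A
    elements : List A

  δ : A → A → ℕ
  δ x y = 𝟙 (does (x ≟′ y))

  field
    -- A single equation encodes both that every element is listed and that none is repeated, in the
    -- form in which sums use it.
    once : ∀ x → ∑ elements (δ x) ≡ 1

  sum : (A → ℕ) → ℕ
  sum = ∑ elements

  δ-refl : ∀ x → δ x x ≡ 1
  δ-refl x with x ≟′ x
  ... | yes _  = refl
  ... | no x≢x = contradiction refl x≢x

  δ-≢ : ∀ {x y} → x ≢ y → δ x y ≡ 0
  δ-≢ {x} {y} x≢y with x ≟′ y
  ... | yes x≡y = contradiction x≡y x≢y
  ... | no _    = refl

  sum-δ : ∀ x f → sum (λ y → δ x y * f y) ≡ f x
  sum-δ x f = begin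
    sum (λ y → δ x y * f y)  ≡⟨ ∑-cong elements pointwise ⟩
    sum (λ y → δ x y * f x)  ≡⟨ ∑-*ʳ elements (f x) (δ x) ⟩
    sum (δ x) * f x          ≡⟨ cong (_* f x) (once x) ⟩
    1 * f x                  ≡⟨ *-identityˡ (f x) ⟩
    f x                      ∎
    where
    open ≡-Reasoning
    pointwise : ∀ y → δ x y * f y ≡ δ x y * f x
    pointwise y with x ≟′ y
    ... | yes refl = refl
    ... | no _     = refl

  sum-*δ : ∀ x c (f : A → ℕ) → sum (λ y → f y * (δ x y * c)) ≡ f x * c
  sum-*δ x c f = trans (∑-cong elements λ y → rearrange (f y) (δ x y) c) (sum-δ x λ y → f y * c)
    where
    open +-*-Solver
    rearrange : ∀ f d c → f * (d * c) ≡ d * (f * c)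
    rearrange = solve 3 (λ f d c → f :* (d :* c) := d :* (f :* c)) refl

  term≤sum : ∀ f x → f x ≤ sum f
  term≤sum f x = subst (_≤ sum f) (sum-δ x f) (∑-mono elements λ y →
    ≤-trans (*-monoˡ-≤ (f y) (𝟙≤1 (does (x ≟′ y)))) (≤-reflexive (*-identityˡ (f y))))

  complete : ∀ x → x ∈ elements
  complete x with ∑-pos elements (δ x) (≤-reflexive (sym (once x)))
  ... | y , y∈ , p with x ≟′ y
  ...   | yes refl = y∈
  ...   | no _     = contradiction p λ ()

  -- Two distinct elements of the support would already contribute 2.
  sum≡1⇒unique : ∀ {f} → sum f ≡ 1 → ∀ {x y} → 1 ≤ f x → 1 ≤ f y → x ≡ y
  sum≡1⇒unique {f} Σf≡1 {x} {y} fx fy with x ≟′ y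
  ... | yes x≡y = x≡y
  ... | no x≢y  = contradiction (subst (2 ≤_) Σf≡1 2≤Σf) λ { (s≤s ()) }
    where
    bound : ∀ z → δ x z + δ y z ≤ f z
    bound z with x ≟′ z | y ≟′ z
    ... | yes refl | yes refl = contradiction refl x≢y
    ... | yes refl | no _     = fx
    ... | no _     | yes refl = fy
    ... | no _     | no _     = z≤n
    2≤Σf : 2 ≤ sum f
    2≤Σf = subst (_≤ sum f)
      (trans (∑-+ elements (δ x) (δ y)) (cong₂ _+_ (once x) (once y)))
      (∑-mono elements bound)

-- Finite projective planes and double counting.

record Plane (q : ℕ) : Set₁ where
  field
    Pt Ln  : Set
    points : Enumeration Pt
    lines  : Enumeration Ln
    _on_   : Pt → Ln → Bool

  module P = Enumeration points
  module L = Enumeration lines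

  ι : Pt → Ln → ℕ
  ι P L = 𝟙 (P on L)

  field
    -- For distinct points this is the unique joining line; for equal points it says that q + 1
    -- lines pass through a point.
    join : ∀ P P′ → L.sum (λ L → ι P L * ι P′ L) ≡ 1 + q * P.δ P P′
    meet : ∀ L L′ → P.sum (λ P → ι P L * ι P L′) ≡ 1 + q * L.δ L L′

  -- Double counting of the flags (P , L), each with weight `v P * w L`.
  exchange : ∀ (v : Pt → ℕ) (w : Ln → ℕ) →
    L.sum (λ L → P.sum (λ P → ι P L * v P) * w L) ≡ P.sum (λ P → v P * L.sum (λ L → ι P L * w L))
  exchange v w = begin
    L.sum (λ L → P.sum (λ P → ι P L * v P) * w L)
      ≡⟨ ∑-cong L.elements (λ L → sym (∑-*ʳ P.elements (w L) _)) ⟩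
    L.sum (λ L → P.sum (λ P → ι P L * v P * w L))
      ≡⟨ ∑-swap L.elements P.elements _ ⟩
    P.sum (λ P → L.sum (λ L → ι P L * v P * w L))
      ≡⟨ ∑-cong P.elements (λ P → trans (∑-cong L.elements λ L → rearrange (ι P L) (v P) (w L))
                                        (∑-*ˡ L.elements (v P) _)) ⟩
    P.sum (λ P → v P * L.sum (λ L → ι P L * w L)) ∎
    where
    open ≡-Reasoning
    open +-*-Solver
    rearrange : ∀ i v w → i * v * w ≡ v * (i * w)
    rearrange = solve 3 (λ i v w → i :* v :* w := v :* (i :* w)) refl

  -- The lines through Q cover Q itself q + 1 times and every other point once.
  pencil-sum : ∀ (v : Pt → ℕ) Q →
    L.sum (λ L → ι Q L * P.sum (λ P → ι P L * v P)) ≡ P.sum v + q * v Q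
  pencil-sum v Q = begin
    L.sum (λ L → ι Q L * P.sum (λ P → ι P L * v P))
      ≡⟨ ∑-cong L.elements (λ L → sym (∑-*ˡ P.elements (ι Q L) _)) ⟩
    L.sum (λ L → P.sum (λ P → ι Q L * (ι P L * v P)))
      ≡⟨ ∑-swap L.elements P.elements _ ⟩
    P.sum (λ P → L.sum (λ L → ι Q L * (ι P L * v P)))
      ≡⟨ ∑-cong P.elements (λ P → ∑-cong L.elements λ L → sym (*-assoc (ι Q L) (ι P L) (v P))) ⟩
    P.sum (λ P → L.sum (λ L → ι Q L * ι P L * v P))
      ≡⟨ ∑-cong P.elements (λ P → trans (∑-*ʳ L.elements (v P) _) (cong (_* v P) (join Q P))) ⟩
    P.sum (λ P → (1 + q * P.δ Q P) * v P)
      ≡⟨ ∑-cong P.elements (λ P → solve 3 (λ q d v → (con 1 :+ q :* d) :* v := v :+ q :* (d :* v)) refl q (P.δ Q P) (v P)) ⟩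
    P.sum (λ P → v P + q * (P.δ Q P * v P))
      ≡⟨ trans (∑-+ P.elements v _) (cong (P.sum v +_) (∑-*ˡ P.elements q _)) ⟩
    P.sum v + q * P.sum (λ P → P.δ Q P * v P)
      ≡⟨ cong (λ x → P.sum v + q * x) (P.sum-δ Q v) ⟩
    P.sum v + q * v Q ∎
    where
    open ≡-Reasoning
    open +-*-Solver

  degree : ∀ P → L.sum (ι P) ≡ 1 + q
  degree P = begin
    L.sum (ι P)                   ≡⟨ ∑-cong L.elements (λ L → sym (𝟙-idem (P on L))) ⟩
    L.sum (λ L → ι P L * ι P L)   ≡⟨ join P P ⟩
    1 + q * P.δ P P               ≡⟨ cong (λ d → 1 + q * d) (P.δ-refl P) ⟩
    1 + q * 1                     ≡⟨ cong (1 +_) (*-identityʳ q) ⟩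
    1 + q                         ∎
    where open ≡-Reasoning

-- The axioms are symmetric, so every count has a dual: for instance, `degree` in the dual plane
-- counts the points of a line.
dual : ∀ {q} → Plane q → Plane q
dual π = record
  { Pt = Ln ; Ln = Pt ; points = lines ; lines = points
  ; _on_ = λ L P → P on L ; join = meet ; meet = join }
  where open Plane π

-- Two auxiliary facts: covering in pairs and a congruence modulo 3.

-- Consecutive entries are paired and one `z` is chosen per pair. The list may have repetitions, so
-- the hypothesis includes the case of equal entries.
pair-cover : ∀ {a b r p} {A : Set a} {B : Set b} {R : B → A → Set r} {Q : B → Set p} n (xs : List A) →
  length xs ≡ n * 2 → (∀ {x y} → x ∈ xs → y ∈ xs → ∃[ z ] (Q z × R z x × R z y)) →
  ∃[ zs ] length zs ≡ n × All Q zs × (∀ {x} → x ∈ xs → Any (λ z → R z x) zs)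
pair-cover zero    []           _   _    = [] , refl , [] , λ ()
pair-cover (suc n) (x ∷ [])     ()  _
pair-cover (suc n) (x ∷ y ∷ xs) len meet =
  let z  , qz , rx , ry = meet (here refl) (there (here refl))
      zs , len′ , qs , r = pair-cover n xs (suc-injective (suc-injective len)) λ i j → meet (there (there i)) (there (there j))
  in z ∷ zs , cong suc len′ , qz ∷ qs ,
     λ { (here refl) → here rx ; (there (here refl)) → here ry ; (there (there i)) → there (r i) }

-- Modulo 3 the left side is `a`, hence 0 or 1, whereas 74 leaves the remainder 2.
a+3b+6c≢74 : ∀ a b c → a ≤ 1 → a + (3 * b + 6 * c) ≢ 74
a+3b+6c≢74 a b c a≤1 eq = go a a≤1 (begin
  a + (b + 2 * c) * 3  ≡⟨ cong (a +_) (sym (thirds b c)) ⟩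
  a + (3 * b + 6 * c)  ≡⟨ eq ⟩
  74                   ∎)
  where
  open ≡-Reasoning
  thirds : ∀ b c → 3 * b + 6 * c ≡ (b + 2 * c) * 3
  thirds = solve 2 (λ b c → con 3 :* b :+ con 6 :* c := (b :+ con 2 :* c) :* con 3) refl
    where open +-*-Solver
  go : ∀ a → a ≤ 1 → a + (b + 2 * c) * 3 ≢ 74
  go 0 _ eq = from-no (3 ∣? 74) (divides (b + 2 * c) (sym eq))
  go 1 _ eq = from-no (3 ∣? 73) (divides (b + 2 * c) (sym (suc-injective eq)))
  go (suc (suc _)) (s≤s ()) _

-- Intersection numbers and tangents of a point set.

module Secants {q} (π : Plane q) (S : Plane.Pt π → Bool) where
  open Plane π public

  σ : Pt → ℕ
  σ P = 𝟙 (S P)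

  k : Ln → ℕ
  k L = P.sum (λ P → ι P L * σ P)

  τ : Ln → ℕ
  τ L = 𝟙 (k L ≡ᵇ 1)

  t : Pt → ℕ
  t P = L.sum (λ L → ι P L * τ L)

  -- Lets `exchange` count a tangent through its only point of S.
  τ*k : ∀ L → τ L ≡ k L * τ L
  τ*k L with k L
  ... | zero        = refl
  ... | suc zero    = refl
  ... | suc (suc n) = sym (*-zeroʳ (2 + n))

  2≤k+τ : ∀ L → 1 ≤ k L → 2 ≤ k L + τ L
  2≤k+τ L with k L
  ... | suc zero    = λ _ → ≤-refl
  ... | suc (suc n) = λ _ → s≤s (s≤s z≤n)

  -- One point of L outside S leaves at most q of the q + 1 points for S.
  k≤q⊎full : ∀ L → k L ≤ q ⊎ (∀ P → P on L ≡ true → S P ≡ true)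
  k≤q⊎full L = go (1 ≤? missing)
    where
    missing : ℕ
    missing = P.sum (λ P → ι P L * 𝟙 (not (S P)))
    missing+k : missing + k L ≡ 1 + q
    missing+k = trans (sym (∑-+ P.elements _ _)) (trans (∑-cong P.elements pointwise) (Plane.degree (dual π) L))
      where
      pointwise : ∀ P → ι P L * 𝟙 (not (S P)) + ι P L * σ P ≡ ι P L
      pointwise P with P on L | S P
      ... | true  | true  = refl
      ... | true  | false = refl
      ... | false | _     = refl
    go : Dec (1 ≤ missing) → _
    go (yes 1≤) = inj₁ (s≤s⁻¹ (subst (1 + k L ≤_) missing+k (+-monoˡ-≤ (k L) 1≤)))
    go (no ≱1)  = inj₂ full
      where
      full : ∀ P → P on L ≡ true → S P ≡ true
      full P PL with S P in P∈S
      ... | true  = refl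
      ... | false = contradiction (≤-trans
        (≤-reflexive (sym (cong₂ (λ a b → 𝟙 a * 𝟙 (not b)) PL P∈S)))
        (P.term≤sum (λ P → ι P L * 𝟙 (not (S P))) P)) ≱1

-- Tangent counts for a blocking semioval of 25 points.

module BlockingSemioval25 (π : Plane 11) (S : Plane.Pt π → Bool)
  (size        : Plane.P.sum π (Secants.σ π S) ≡ 25)
  (blocking    : ∀ L → 1 ≤ Secants.k π S L)
  (one-tangent : ∀ {P} → S P ≡ true → Secants.t π S P ≡ 1)
  where
  open Secants π S

  σ*t : ∀ P → σ P * t P ≡ σ P
  σ*t P with S P in eq
  ... | true  = trans (*-identityˡ (t P)) (one-tangent eq)
  ... | false = refl

  -- Each point of S lies on one tangent and each tangent has one point of S.
  tangents : L.sum τ ≡ 25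
  tangents = begin
    L.sum τ                  ≡⟨ ∑-cong L.elements τ*k ⟩
    L.sum (λ L → k L * τ L)  ≡⟨ exchange σ τ ⟩
    P.sum (λ P → σ P * t P)  ≡⟨ ∑-cong P.elements σ*t ⟩
    P.sum σ                  ≡⟨ size ⟩
    25                       ∎
    where open ≡-Reasoning

  pencil : ∀ Q → L.sum (λ L → ι Q L * k L) ≡ 25 + 11 * σ Q
  pencil Q = trans (pencil-sum σ Q) (cong (_+ 11 * σ Q) size)

  tangents-along : ∀ ℓ → P.sum (λ P → ι P ℓ * t P) ≡ 25 + 11 * τ ℓ
  tangents-along ℓ = trans (Plane.pencil-sum (dual π) τ ℓ) (cong (_+ 11 * τ ℓ) tangents)

  -- A tangent is counted with multiplicity 2, so that every line of the pencil
  -- contributes at least 2.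
  pencil-excess : ∀ P (w : Ln → ℕ) → (∀ L → 2 + w L ≤ k L + τ L) →
                  24 + L.sum (λ L → ι P L * w L) ≤ 25 + 11 * σ P + t P
  pencil-excess P w bound = begin
    24 + L.sum (λ L → ι P L * w L)
      ≡⟨ cong (_+ L.sum (λ L → ι P L * w L)) (sym (trans (∑-*ʳ L.elements 2 (ι P)) (cong (_* 2) (degree P)))) ⟩
    L.sum (λ L → ι P L * 2) + L.sum (λ L → ι P L * w L)
      ≡⟨ sym (∑-+ L.elements _ _) ⟩
    L.sum (λ L → ι P L * 2 + ι P L * w L)
      ≤⟨ ∑-mono L.elements (λ L → ≤-trans (≤-reflexive (sym (*-distribˡ-+ (ι P L) 2 (w L)))) (*-monoʳ-≤ (ι P L) (bound L))) ⟩
    L.sum (λ L → ι P L * (k L + τ L))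
      ≡⟨ trans (∑-cong L.elements (λ L → *-distribˡ-+ (ι P L) (k L) (τ L))) (∑-+ L.elements _ _) ⟩
    L.sum (λ L → ι P L * k L) + t P
      ≡⟨ cong (_+ t P) (pencil P) ⟩
    25 + 11 * σ P + t P ∎
    where open ≤-Reasoning

  -- For Q outside S the values of `k + τ` in the pencil add up to 25 + t(Q), and the twelve lines
  -- already account for 24.
  off-excess : ∀ {Q} (w : Ln → ℕ) → S Q ≡ false → (∀ L → 2 + w L ≤ k L + τ L) →
               L.sum (λ L → ι Q L * w L) ≤ 1 + t Q
  off-excess {Q} w Q∉S bound =
    +-cancelˡ-≤ 24 _ _ (subst (λ b → 24 + L.sum (λ L → ι Q L * w L) ≤ 25 + 11 * 𝟙 b + t Q) Q∉S (pencil-excess Q w bound))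

  -- As ℓ is no tangent, its points carry 25 tangents in all: one at each of the k points of S and
  -- at least `c + w` at each of the 12 - k others. The term `c * k ℓ` on the right replaces a
  -- subtraction.
  line-excess : ∀ {ℓ} c (w : Pt → ℕ) → 2 ≤ k ℓ →
    (∀ P → S P ≡ true → w P ≡ 0) →
    (∀ P → P on ℓ ≡ true → S P ≡ false → c + w P ≤ t P) →
    c * 12 + k ℓ + P.sum (λ P → ι P ℓ * w P) ≤ 25 + c * k ℓ
  line-excess {ℓ} c w 2≤k w-on bound = begin
    c * 12 + k ℓ + P.sum (λ P → ι P ℓ * w P)
      ≡⟨ cong (λ x → x + k ℓ + P.sum (λ P → ι P ℓ * w P)) (sym (trans (∑-*ˡ P.elements c _) (cong (c *_) (Plane.degree (dual π) ℓ)))) ⟩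
    P.sum (λ P → c * ι P ℓ) + k ℓ + P.sum (λ P → ι P ℓ * w P)
      ≡⟨ cong (_+ P.sum (λ P → ι P ℓ * w P)) (sym (∑-+ P.elements _ _)) ⟩
    P.sum (λ P → c * ι P ℓ + ι P ℓ * σ P) + P.sum (λ P → ι P ℓ * w P)
      ≡⟨ sym (∑-+ P.elements _ _) ⟩
    P.sum (λ P → c * ι P ℓ + ι P ℓ * σ P + ι P ℓ * w P)
      ≤⟨ ∑-mono P.elements pointwise ⟩
    P.sum (λ P → ι P ℓ * t P + c * (ι P ℓ * σ P))
      ≡⟨ trans (∑-+ P.elements _ _) (cong₂ _+_ (tangents-along ℓ) (∑-*ˡ P.elements c _)) ⟩
    25 + 11 * τ ℓ + c * k ℓ
      ≡⟨ cong (λ x → 25 + 11 * x + c * k ℓ) (τ≡0 (k ℓ) 2≤k) ⟩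
    25 + c * k ℓ ∎
    where
    open ≤-Reasoning
    τ≡0 : ∀ j → 2 ≤ j → 𝟙 (j ≡ᵇ 1) ≡ 0
    τ≡0 (suc (suc j)) _ = refl
    τ≡0 (suc zero) (s≤s ())
    pointwise : ∀ P → c * ι P ℓ + ι P ℓ * σ P + ι P ℓ * w P ≤ ι P ℓ * t P + c * (ι P ℓ * σ P)
    pointwise P with P on ℓ in Pℓ | S P in inS
    ... | false | _ rewrite *-zeroʳ c = z≤n
    ... | true  | true rewrite w-on P inS | one-tangent inS | *-identityʳ c = ≤-reflexive (trans (+-identityʳ (c + 1)) (+-comm c 1))
    ... | true  | false rewrite *-identityʳ c | *-zeroʳ c | +-identityʳ c | +-identityʳ (w P) | +-identityʳ (t P) | +-identityʳ (t P) = bound P Pℓ inS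

  -- In the pencil at Q the line ℓ exceeds the guaranteed 2 by 1 + c, and all but 1 of this must
  -- come from t(Q).
  off-tangents : ∀ {Q ℓ} c → k ℓ ≡ 3 + c → Q on ℓ ≡ true → S Q ≡ false → c ≤ t Q
  off-tangents {Q} {ℓ} c kℓ Qℓ Q∉S = s≤s⁻¹ (subst (_≤ 1 + t Q) sum≡ (off-excess w Q∉S bound))
    where
    w : Ln → ℕ
    w L = L.δ ℓ L * (1 + c)
    bound : ∀ L → 2 + w L ≤ k L + τ L
    bound L with ℓ L.≟′ L
    ... | yes refl rewrite kℓ | +-identityʳ c = ≤-refl
    ... | no _     = 2≤k+τ L (blocking L)
    sum≡ : L.sum (λ L → ι Q L * w L) ≡ 1 + c
    sum≡ = trans (L.sum-*δ ℓ (1 + c) (ι Q)) (trans (cong (λ b → 𝟙 b * (1 + c)) Qℓ) (*-identityˡ (1 + c)))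

  -- With k = 3 + c this reads (12 - k)(k - 3) + k ≤ 25, which fails for k = 7, 8, 9.
  lower-bound : ∀ {ℓ} c → k ℓ ≡ 3 + c → c * 12 + (3 + c) ≤ 25 + c * (3 + c)
  lower-bound {ℓ} c kℓ = subst (λ k → c * 12 + k ≤ 25 + c * k) kℓ (m+n≤o⇒m≤o (c * 12 + k ℓ)
    (line-excess c (λ _ → 0) (subst (2 ≤_) (sym kℓ) (s≤s (s≤s z≤n))) (λ _ _ → refl)
      λ P Pℓ P∉S → subst (_≤ t P) (sym (+-identityʳ c)) (off-tangents c kℓ Pℓ P∉S)))

  t≤12 : ∀ P → t P ≤ 12
  t≤12 P = subst (t P ≤_) (degree P) (∑-mono L.elements λ L →
    ≤-trans (*-monoʳ-≤ (ι P L) (𝟙≤1 (k L ≡ᵇ 1))) (≤-reflexive (*-identityʳ (ι P L))))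

  -- The only point of an 11-secant outside S would lie on 14 tangents.
  k≢11 : ∀ ℓ → k ℓ ≢ 11
  k≢11 ℓ kℓ = from-no (157 ≤? 155) (begin
    157                                               ≡⟨ cong₂ (λ x y → 25 + 11 * 𝟙 (x ≡ᵇ 1) + 12 * y) (sym kℓ) (sym kℓ) ⟩
    25 + 11 * τ ℓ + 12 * k ℓ                          ≡⟨ sym (trans (∑-+ P.elements _ _) (cong₂ _+_ (tangents-along ℓ) (∑-*ˡ P.elements 12 _))) ⟩
    P.sum (λ P → ι P ℓ * t P + 12 * (ι P ℓ * σ P))    ≤⟨ ∑-mono P.elements pointwise ⟩
    P.sum (λ P → 12 * ι P ℓ + ι P ℓ * σ P)            ≡⟨ trans (∑-+ P.elements _ _) (cong (_+ k ℓ) (∑-*ˡ P.elements 12 _)) ⟩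
    12 * P.sum (λ P → ι P ℓ) + k ℓ                    ≡⟨ cong₂ (λ x y → 12 * x + y) (Plane.degree (dual π) ℓ) kℓ ⟩
    155 ∎)
    where
    open ≤-Reasoning
    -- The multiples of 12 avoid subtraction: a point of S gives 13 on both sides, and any other
    -- point of ℓ needs just `t≤12`.
    pointwise : ∀ P → ι P ℓ * t P + 12 * (ι P ℓ * σ P) ≤ 12 * ι P ℓ + ι P ℓ * σ P
    pointwise P with P on ℓ | S P in inS
    ... | false | _     = z≤n
    ... | true  | true  rewrite one-tangent inS = ≤-refl
    ... | true  | false rewrite +-identityʳ (t P) | +-identityʳ (t P) = t≤12 P

  -- Ten-secants and a set of 20 points.

  tangents-at-unique : ∀ {P T T′} → S P ≡ true → P on T ≡ true → P on T′ ≡ true → k T ≡ 1 → k T′ ≡ 1 → T ≡ T′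
  tangents-at-unique {P} P∈S PT PT′ kT kT′ = L.sum≡1⇒unique (one-tangent P∈S) (counted PT kT) (counted PT′ kT′)
    where
    counted : ∀ {L} → P on L ≡ true → k L ≡ 1 → 1 ≤ ι P L * τ L
    counted PL kL rewrite PL | kL = ≤-refl

  meet-≢ : ∀ {L L′} → L ≢ L′ → P.sum (λ P → ι P L * ι P L′) ≡ 1
  meet-≢ {L} {L′} L≢L′ = trans (meet L L′) (cong (λ d → 1 + 11 * d) (L.δ-≢ L≢L′))

  -- The lines other than ℓ missed by S ∖ ℓ are the ten tangents at the points
  -- of ℓ.  Two of these meet off ℓ, so five points block them all.
  block-off-10-secant : ∀ ℓ → k ℓ ≡ 10 → ∃[ B ] length B ≡ 20 × All (λ P → P on ℓ ≡ false) B ×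
                        (∀ L → L ≢ ℓ → Any (λ P → P on L ≡ true) B)
  block-off-10-secant ℓ kℓ = B₁ ++ B₂ ,
    trans (length-++ B₁) (cong₂ _+_ |B₁| |B₂|) ,
    All.++⁺ B₁-off B₂-off ,
    λ L L≢ℓ → blocked L L≢ℓ (1 ≤? P.sum (λ P → ι P L * 𝟙 (off P)))
    where
    off : Pt → Bool
    off P = S P ∧ not (P on ℓ)

    B₁ : List Pt
    B₁ = filterᵇ off P.elements

    |B₁| : length B₁ ≡ 15
    |B₁| = +-cancelʳ-≡ 10 _ _ (begin
      length B₁ + 10                             ≡⟨ cong₂ _+_ (length-filter≡∑ (T? ∘ off) P.elements) (sym kℓ) ⟩
      P.sum (λ P → 𝟙 (off P)) + k ℓ              ≡⟨ sym (∑-+ P.elements _ _) ⟩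
      P.sum (λ P → 𝟙 (off P) + ι P ℓ * σ P)      ≡⟨ ∑-cong P.elements pointwise ⟩
      P.sum σ                                    ≡⟨ size ⟩
      25                                         ∎)
      where
      open ≡-Reasoning
      pointwise : ∀ P → 𝟙 (off P) + ι P ℓ * σ P ≡ σ P
      pointwise P with S P | P on ℓ
      ... | true  | true  = refl
      ... | true  | false = refl
      ... | false | true  = refl
      ... | false | false = refl

    B₁-off : All (λ P → P on ℓ ≡ false) B₁
    B₁-off = All.map (λ {P} → lemma (S P) (P on ℓ)) (All.all-filter (T? ∘ off) P.elements)
      where
      lemma : ∀ s b → T (s ∧ not b) → b ≡ false
      lemma true false _ = refl

    contact : Ln → ℕ
    contact L = P.sum (λ P → ι P L * (ι P ℓ * σ P))

    contact≤k : ∀ L → contact L ≤ k L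
    contact≤k L = ∑-mono P.elements λ P → *-monoʳ-≤ (ι P L)
      (≤-trans (*-monoˡ-≤ (σ P) (𝟙≤1 (P on ℓ))) (≤-reflexive (*-identityˡ (σ P))))

    -- Selects the tangents whose only point of S lies on ℓ.
    isT : Ln → Bool
    isT L = (k L ≡ᵇ 1) ∧ (contact L ≡ᵇ 1)

    tangents-at-ℓ : List Ln
    tangents-at-ℓ = filterᵇ isT L.elements

    |tangents-at-ℓ| : length tangents-at-ℓ ≡ 10
    |tangents-at-ℓ| = begin
      length tangents-at-ℓ                       ≡⟨ length-filter≡∑ (T? ∘ isT) L.elements ⟩
      L.sum (λ L → 𝟙 (isT L))                    ≡⟨ ∑-cong L.elements (λ L → as-product (k L) (contact L) (contact≤k L)) ⟩
      L.sum (λ L → contact L * τ L)              ≡⟨ exchange (λ P → ι P ℓ * σ P) τ ⟩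
      P.sum (λ P → ι P ℓ * σ P * t P)            ≡⟨ ∑-cong P.elements pointwise ⟩
      k ℓ                                        ≡⟨ kℓ ⟩
      10                                         ∎
      where
      open ≡-Reasoning
      -- For k = 1 the bound c ≤ k makes c its own indicator.
      as-product : ∀ k c → c ≤ k → 𝟙 ((k ≡ᵇ 1) ∧ (c ≡ᵇ 1)) ≡ c * 𝟙 (k ≡ᵇ 1)
      as-product 0             c _ = sym (*-zeroʳ c)
      as-product 1             0 _ = refl
      as-product 1             1 _ = refl
      as-product 1             (suc (suc c)) (s≤s ())
      as-product (suc (suc k)) c _ = sym (*-zeroʳ c)
      pointwise : ∀ P → ι P ℓ * σ P * t P ≡ ι P ℓ * σ P
      pointwise P = trans (*-assoc (ι P ℓ) (σ P) (t P)) (cong (ι P ℓ *_) (σ*t P))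

    isT⇒ : ∀ {L} → L ∈ tangents-at-ℓ → k L ≡ 1 × contact L ≡ 1
    isT⇒ {L} L∈ = let p , q = Equivalence.to T-∧ (proj₂ (∈-filter⁻ (T? ∘ isT) {xs = L.elements} L∈))
                  in ≡ᵇ⇒≡ (k L) 1 p , ≡ᵇ⇒≡ (contact L) 1 q

    meet-off-ℓ : ∀ {T T′} → T ∈ tangents-at-ℓ → T′ ∈ tangents-at-ℓ →
                 ∃[ M ] (M on ℓ ≡ false × M on T ≡ true × M on T′ ≡ true)
    meet-off-ℓ {T} {T′} T∈ T′∈ = go (T L.≟′ T′)
      where
      kT = proj₁ (isT⇒ T∈)
      T≢ℓ : T ≢ ℓ
      T≢ℓ refl = contradiction (trans (sym kT) kℓ) λ ()
      point-of-T : ∃[ M ] (M on ℓ ≡ false × M on T ≡ true)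
      point-of-T = let M , _ , 1≤ = ∑-pos P.elements _ (subst (1 ≤_) (sym 11≡) (s≤s z≤n))
                       MT , M∉ℓ = *-pos (ι M T) _ 1≤
                   in M , not-true (𝟙-pos _ M∉ℓ) , 𝟙-pos _ MT
        where
        not-true : ∀ {b} → not b ≡ true → b ≡ false
        not-true {false} _ = refl
        pointwise : ∀ P → ι P T * 𝟙 (not (P on ℓ)) + ι P T * ι P ℓ ≡ ι P T
        pointwise P with P on T | P on ℓ
        ... | true  | true  = refl
        ... | true  | false = refl
        ... | false | _     = refl
        11≡ : P.sum (λ P → ι P T * 𝟙 (not (P on ℓ))) ≡ 11
        11≡ = +-cancelʳ-≡ 1 _ 11 (trans (cong₂ _+_ refl (sym (meet-≢ T≢ℓ)))
          (trans (sym (∑-+ P.elements _ _)) (trans (∑-cong P.elements pointwise) (Plane.degree (dual π) T))))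
      go : Dec (T ≡ T′) → _
      -- The pairing may put equal entries together; then any point of T off ℓ serves.
      go (yes refl) = let M , M∉ℓ , MT = point-of-T in M , M∉ℓ , MT , MT
      go (no T≢T′) with ∑-pos P.elements _ (≤-reflexive (sym (meet-≢ T≢T′)))
      ... | M , _ , 1≤ with *-pos (ι M T) (ι M T′) 1≤
      ...   | MT , MT′ with M on ℓ in Mℓ
      ...     | false = M , Mℓ , 𝟙-pos _ MT , 𝟙-pos _ MT′
      -- T meets ℓ only once, so M is the point of contact P of T. Then T and T′ would be two
      -- tangents at a point of S.
      ...     | true  with ∑-pos P.elements _ (≤-reflexive (sym (proj₂ (isT⇒ T∈))))
      ...       | P , _ , 1≤′ with *-pos (ι P T) _ 1≤′
      ...         | PT , q with *-pos (ι P ℓ) (σ P) q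
      ...           | Pℓ , P∈S with P.sum≡1⇒unique (meet-≢ T≢ℓ)
                                      (*-mono-≤ PT Pℓ) (*-mono-≤ MT (≤-reflexive (cong 𝟙 (sym Mℓ))))
      ...             | refl = contradiction
        (tangents-at-unique (𝟙-pos _ P∈S) (𝟙-pos _ MT) (𝟙-pos _ MT′) kT (proj₁ (isT⇒ T′∈))) T≢T′

    cover : ∃[ B ] length B ≡ 5 × All (λ P → P on ℓ ≡ false) B ×
            (∀ {L} → L ∈ tangents-at-ℓ → Any (λ P → P on L ≡ true) B)
    cover = pair-cover 5 tangents-at-ℓ |tangents-at-ℓ| meet-off-ℓ

    B₂     = proj₁ cover
    |B₂|   = proj₁ (proj₂ cover)
    B₂-off = proj₁ (proj₂ (proj₂ cover))

    -- If L misses the points of S off ℓ, all its points of S lie on ℓ. There is then exactly one,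
    -- so L is one of the ten tangents, which `B₂` blocks.
    blocked : ∀ L → L ≢ ℓ → Dec (1 ≤ P.sum (λ P → ι P L * 𝟙 (off P))) → Any (λ P → P on L ≡ true) (B₁ ++ B₂)
    blocked L L≢ℓ (yes 1≤) = let P , P∈ , q = ∑-pos P.elements _ 1≤
                                 PL , offP = *-pos (ι P L) _ q
                             in Any.++⁺ˡ (lose (∈-filter⁺ (T? ∘ off) P∈ (Equivalence.from T-≡ (𝟙-pos _ offP))) (𝟙-pos _ PL))
    blocked L L≢ℓ (no ≱1)  = Any.++⁺ʳ B₁ (proj₂ (proj₂ (proj₂ cover))
      (∈-filter⁺ (T? ∘ isT) (L.complete L) (Equivalence.from T-∧ (≡⇒≡ᵇ (k L) 1 (trans k≡contact contact≡1) , ≡⇒≡ᵇ (contact L) 1 contact≡1))))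
      where
      pointwise : ∀ P → ι P L * σ P ≡ ι P L * 𝟙 (off P) + ι P L * (ι P ℓ * σ P)
      pointwise P with P on L | S P | P on ℓ
      ... | false | _     | _     = refl
      ... | true  | false | true  = refl
      ... | true  | false | false = refl
      ... | true  | true  | true  = refl
      ... | true  | true  | false = refl
      k≡contact : k L ≡ contact L
      k≡contact = trans (∑-cong P.elements pointwise) (trans (∑-+ P.elements _ _)
        (cong (_+ contact L) (n<1⇒n≡0 (≰⇒> ≱1))))
      contact≡1 : contact L ≡ 1
      contact≡1 = ≤-antisym
        (subst (contact L ≤_) (meet-≢ L≢ℓ) (∑-mono P.elements λ P → *-monoʳ-≤ (ι P L)
          (≤-trans (*-monoʳ-≤ (ι P ℓ) (𝟙≤1 (S P))) (≤-reflexive (*-identityʳ (ι P ℓ))))))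
        (subst (1 ≤_) k≡contact (blocking L))

  -- Excluding more than six points of S on a line.

  module _ (k≤11 : ∀ ℓ → k ℓ ≤ 11) (k≢10 : ∀ ℓ → k ℓ ≢ 10) (133-lines : L.sum (λ _ → 1) ≡ 133) where

    k≤6 : ∀ ℓ → k ℓ ≤ 6
    k≤6 ℓ = go (k ℓ) refl (k≤11 ℓ)
      where
      go : ∀ j → k ℓ ≡ j → j ≤ 11 → j ≤ 6
      go 0  _  _ = z≤n
      go 1  _  _ = from-yes (1 ≤? 6)
      go 2  _  _ = from-yes (2 ≤? 6)
      go 3  _  _ = from-yes (3 ≤? 6)
      go 4  _  _ = from-yes (4 ≤? 6)
      go 5  _  _ = from-yes (5 ≤? 6)
      go 6  _  _ = from-yes (6 ≤? 6)
      -- The argument of `lower-bound` is the intersection size minus 3.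
      go 7  kℓ _ = contradiction (lower-bound 4 kℓ) (from-no (55 ≤? 53))
      go 8  kℓ _ = contradiction (lower-bound 5 kℓ) (from-no (68 ≤? 65))
      go 9  kℓ _ = contradiction (lower-bound 6 kℓ) (from-no (81 ≤? 79))
      go 10 kℓ _ = contradiction kℓ (k≢10 ℓ)
      go 11 kℓ _ = contradiction kℓ (k≢11 ℓ)
      go (suc (suc (suc (suc (suc (suc (suc (suc (suc (suc (suc (suc j)))))))))))) _ j≤11 =
        contradiction (≤-trans (m≤m+n 12 j) j≤11) (from-no (12 ≤? 11))

    #_-secants : ℕ → ℕ
    # i -secants = L.sum (λ L → 𝟙 (k L ≡ᵇ i))

    -- 6-secants in the presence of a 4-secant.

    module _ {m} (km : k m ≡ 4) where

      -- Were Q outside S, the excesses 4 of ℓ and 2 of m would force t(Q) ≥ 5. The other five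
      -- points of ℓ outside S have at least 3 tangents each, so ℓ would carry 6 + 5 · 3 + 5 = 26
      -- tangents instead of 25.
      6∩4⊆S : ∀ {ℓ Q} → k ℓ ≡ 6 → Q on ℓ ≡ true → Q on m ≡ true → S Q ≡ true
      6∩4⊆S {ℓ} {Q} kℓ Qℓ Qm with S Q in Q∉S
      ... | true  = refl
      ... | false = contradiction
        (subst₂ (λ k e → 36 + k + e ≤ 25 + 3 * k) kℓ
          (trans (P.sum-*δ Q 2 (λ P → ι P ℓ)) (cong (λ b → 𝟙 b * 2) Qℓ))
          (line-excess 3 v (subst (2 ≤_) (sym kℓ) (from-yes (2 ≤? 6))) v-on v-off))
        (from-no (44 ≤? 43))
        where
        w : Ln → ℕ
        w L = L.δ ℓ L * 4 + L.δ m L * 2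
        w-bound : ∀ L → 2 + w L ≤ k L + τ L
        w-bound L with ℓ L.≟′ L | m L.≟′ L
        ... | yes refl | yes refl = contradiction (trans (sym km) kℓ) λ ()
        ... | yes refl | no _ rewrite kℓ = ≤-refl
        ... | no _     | yes refl rewrite km = ≤-refl
        ... | no _     | no _     = 2≤k+τ L (blocking L)
        5≤t : 5 ≤ t Q
        5≤t = s≤s⁻¹ (subst (_≤ 1 + t Q) sum≡6 (off-excess w Q∉S w-bound))
          where
          sum≡6 : L.sum (λ L → ι Q L * w L) ≡ 6
          sum≡6 = trans (∑-cong L.elements λ L → *-distribˡ-+ (ι Q L) (L.δ ℓ L * 4) (L.δ m L * 2))
            (trans (∑-+ L.elements _ _) (cong₂ _+_
              (trans (L.sum-*δ ℓ 4 (ι Q)) (cong (λ b → 𝟙 b * 4) Qℓ))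
              (trans (L.sum-*δ m 2 (ι Q)) (cong (λ b → 𝟙 b * 2) Qm))))
        -- The two tangents at Q beyond the three that ℓ alone forces.
        v : Pt → ℕ
        v P = P.δ Q P * 2
        v-on : ∀ P → S P ≡ true → v P ≡ 0
        v-on P P∈S = cong (_* 2) (P.δ-≢ λ { refl → contradiction (trans (sym P∈S) Q∉S) λ () })
        v-off : ∀ P → P on ℓ ≡ true → S P ≡ false → 3 + v P ≤ t P
        v-off P Pℓ P∉S with Q P.≟′ P
        ... | yes refl = 5≤t
        ... | no _     = off-tangents 3 kℓ Pℓ P∉S

      -- The values of `k + τ` in the pencil at P add up to 37. Twelve lines use 24, m adds 2 and
      -- each 6-secant adds 4, so three 6-secants would need 38.
      6-secants-at : ∀ {P} → S P ≡ true → P on m ≡ true → L.sum (λ L → ι P L * 𝟙 (k L ≡ᵇ 6)) ≤ 2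
      6-secants-at {P} P∈S Pm = r≤2 (L.sum (λ L → ι P L * 𝟙 (k L ≡ᵇ 6)))
        (subst₂ _≤_ (cong (24 +_) sum≡) (cong₂ (λ b t → 25 + 11 * 𝟙 b + t) P∈S (one-tangent P∈S))
          (pencil-excess P w w-bound))
        where
        w : Ln → ℕ
        w L = 𝟙 (k L ≡ᵇ 6) * 4 + L.δ m L * 2
        w-bound : ∀ L → 2 + w L ≤ k L + τ L
        w-bound L with m L.≟′ L
        ... | yes refl rewrite km = ≤-refl
        ... | no _ with k L ≡ᵇ 6 in eq
        ...   | true  rewrite ≡ᵇ⇒≡ (k L) 6 (subst T (sym eq) _) = ≤-refl
        ...   | false = 2≤k+τ L (blocking L)
        sum≡ : L.sum (λ L → ι P L * w L) ≡ L.sum (λ L → ι P L * 𝟙 (k L ≡ᵇ 6)) * 4 + 2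
        sum≡ = trans (∑-cong L.elements λ L → trans (*-distribˡ-+ (ι P L) _ (L.δ m L * 2))
                        (cong (_+ ι P L * (L.δ m L * 2)) (sym (*-assoc (ι P L) (𝟙 (k L ≡ᵇ 6)) 4))))
          (trans (∑-+ L.elements _ _) (cong₂ _+_
            (∑-*ʳ L.elements 4 _)
            (trans (L.sum-*δ m 2 (ι P)) (cong (λ b → 𝟙 b * 2) Pm))))
        r≤2 : ∀ r → 24 + (r * 4 + 2) ≤ 37 → r ≤ 2
        r≤2 0 _ = z≤n
        r≤2 1 _ = s≤s z≤n
        r≤2 2 _ = ≤-refl
        r≤2 (suc (suc (suc r))) le = contradiction
          (≤-trans (+-monoʳ-≤ 24 (+-monoˡ-≤ 2 (m≤m+n 12 (r * 4)))) le) (from-no (38 ≤? 37))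

      -- Each 6-secant meets m in one of the four points of S on m, and each of these lies on at
      -- most two 6-secants.
      #6-secants≤8 : # 6 -secants ≤ 8
      #6-secants≤8 = begin
        # 6 -secants
          ≤⟨ ∑-mono L.elements meets-in-S ⟩
        L.sum (λ L → P.sum (λ P → ι P L * (ι P m * σ P)) * six L)
          ≡⟨ exchange (λ P → ι P m * σ P) six ⟩
        P.sum (λ P → ι P m * σ P * L.sum (λ L → ι P L * six L))
          ≤⟨ ∑-mono P.elements pointwise ⟩
        P.sum (λ P → ι P m * σ P * 2)
          ≡⟨ ∑-*ʳ P.elements 2 _ ⟩
        k m * 2
          ≡⟨ cong (_* 2) km ⟩
        8 ∎
        where
        open ≤-Reasoning
        six : Ln → ℕ
        six L = 𝟙 (k L ≡ᵇ 6)
        meets-in-S : ∀ L → six L ≤ P.sum (λ P → ι P L * (ι P m * σ P)) * six L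
        meets-in-S L with k L ≡ᵇ 6 in eq
        ... | false = z≤n
        ... | true  = ≤-trans (subst (_≤ P.sum (λ P → ι P L * (ι P m * σ P))) one (∑-mono P.elements in-S))
                              (≤-reflexive (sym (*-identityʳ _)))
          where
          kL : k L ≡ 6
          kL = ≡ᵇ⇒≡ (k L) 6 (subst T (sym eq) _)
          one : P.sum (λ P → ι P L * ι P m) ≡ 1
          one = trans (meet L m) (cong (λ d → 1 + 11 * d)
            (L.δ-≢ λ { refl → contradiction (trans (sym km) kL) λ () }))
          in-S : ∀ P → ι P L * ι P m ≤ ι P L * (ι P m * σ P)
          in-S P with P on L in PL | P on m in Pm
          ... | false | _     = z≤n
          ... | true  | false = z≤n
          ... | true  | true rewrite 6∩4⊆S kL PL Pm = ≤-refl
        pointwise : ∀ P → ι P m * σ P * L.sum (λ L → ι P L * six L) ≤ ι P m * σ P * 2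
        pointwise P with P on m in Pm | S P in P∈S
        ... | false | _     = z≤n
        ... | true  | false = z≤n
        ... | true  | true  = *-monoʳ-≤ 1 (6-secants-at P∈S Pm)

    -- The standard equations for the numbers of i-secants.

    private
      x : ℕ → ℕ
      x i = # i -secants

    incidences : L.sum k ≡ 300
    incidences = begin
      L.sum k                                   ≡⟨ ∑-cong L.elements (λ L → sym (*-identityʳ (k L))) ⟩
      L.sum (λ L → k L * 1)                     ≡⟨ exchange σ (λ _ → 1) ⟩
      P.sum (λ P → σ P * L.sum (λ L → ι P L * 1)) ≡⟨ ∑-cong P.elements (λ P → cong (σ P *_)
                                                     (trans (∑-*ʳ L.elements 1 (ι P)) (cong (_* 1) (degree P)))) ⟩
      P.sum (λ P → σ P * 12)                    ≡⟨ ∑-*ʳ P.elements 12 σ ⟩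
      P.sum σ * 12                              ≡⟨ cong (_* 12) {P.sum σ} {25} size ⟩
      300                                       ∎
      where open ≡-Reasoning

    -- Pairs of equal points are included: from a point of S, each of the 24 others is seen on one
    -- line and the point itself on twelve, which makes 36.
    ordered-pairs : L.sum (λ L → k L * k L) ≡ 900
    ordered-pairs = begin
      L.sum (λ L → k L * k L)                     ≡⟨ exchange σ k ⟩
      P.sum (λ P → σ P * L.sum (λ L → ι P L * k L)) ≡⟨ ∑-cong P.elements pointwise ⟩
      P.sum (λ P → σ P * 36)                      ≡⟨ ∑-*ʳ P.elements 36 σ ⟩
      P.sum σ * 36                                ≡⟨ cong (_* 36) {P.sum σ} {25} size ⟩
      900                                         ∎
      where
      open ≡-Reasoning
      pointwise : ∀ P → σ P * L.sum (λ L → ι P L * k L) ≡ σ P * 36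
      pointwise P = trans (cong (σ P *_) (pencil P)) (by-membership (S P))
        where
        by-membership : ∀ b → 𝟙 b * (25 + 11 * 𝟙 b) ≡ 𝟙 b * 36
        by-membership true  = refl
        by-membership false = refl

    private
      [k≡_] : ℕ → Ln → ℕ
      [k≡ i ] L = 𝟙 (k L ≡ᵇ i)

      Y : Ln → ℕ
      Y L = [k≡ 4 ] L + (3 * [k≡ 5 ] L + 6 * [k≡ 6 ] L)

      sum-Y : L.sum Y ≡ x 4 + (3 * x 5 + 6 * x 6)
      sum-Y = trans (∑-+ L.elements _ _) (cong (x 4 +_)
        (trans (∑-+ L.elements _ _) (cong₂ _+_ (∑-*ˡ L.elements 3 _) (∑-*ˡ L.elements 6 _))))

      sum-const : ∀ c → L.sum (λ _ → c) ≡ c * 133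
      sum-const c = trans (∑-cong L.elements λ _ → sym (*-identityʳ c))
                          (trans (∑-*ˡ L.elements c (λ _ → 1)) (cong (c *_) 133-lines))

      -- As 1 ≤ k ≤ 6, an identity between functions of k reduces to six evaluations.
      by-size : ∀ (f g : ℕ → ℕ) → f 1 ≡ g 1 → f 2 ≡ g 2 → f 3 ≡ g 3 → f 4 ≡ g 4 → f 5 ≡ g 5 → f 6 ≡ g 6 →
                ∀ L → f (k L) ≡ g (k L)
      by-size f g e₁ e₂ e₃ e₄ e₅ e₆ L = go (k L) (blocking L) (k≤6 L)
        where
        go : ∀ j → 1 ≤ j → j ≤ 6 → f j ≡ g j
        go 1 _ _ = e₁
        go 2 _ _ = e₂
        go 3 _ _ = e₃
        go 4 _ _ = e₄
        go 5 _ _ = e₅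
        go 6 _ _ = e₆
        go (suc (suc (suc (suc (suc (suc (suc j))))))) _ le = contradiction (≤-trans (m≤m+n 7 j) le) (from-no (7 ≤? 6))

    -- From (k − 2)(k − 3) = 2, 0, 0, 2, 6, 12 for k = 1, …, 6.
    x₄+3x₅+6x₆ : x 4 + (3 * x 5 + 6 * x 6) ≡ 74
    -- Here 1550 = 5 · 300 + 2 · 25 collects the term 5k and the tangents, and 1698 = 900 + 6 · 133.
    x₄+3x₅+6x₆ = *-cancelˡ-≡ _ 74 2 (+-cancelʳ-≡ 1550 _ _ (begin
      2 * (x 4 + (3 * x 5 + 6 * x 6)) + 1550
        ≡⟨ cong₂ (λ a b → 2 * a + b) (sym sum-Y) (sym (cong₂ (λ a b → 5 * a + 2 * b) incidences tangents)) ⟩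
      2 * L.sum Y + (5 * L.sum k + 2 * L.sum τ)
        ≡⟨ sym (trans (∑-+ L.elements _ _) (cong₂ _+_ (∑-*ˡ L.elements 2 Y)
             (trans (∑-+ L.elements _ _) (cong₂ _+_ (∑-*ˡ L.elements 5 k) (∑-*ˡ L.elements 2 τ))))) ⟩
      L.sum (λ L → 2 * Y L + (5 * k L + 2 * τ L))
        ≡⟨ ∑-cong L.elements (by-size
             (λ j → 2 * (𝟙 (j ≡ᵇ 4) + (3 * 𝟙 (j ≡ᵇ 5) + 6 * 𝟙 (j ≡ᵇ 6))) + (5 * j + 2 * 𝟙 (j ≡ᵇ 1)))
             (λ j → j * j + 6) refl refl refl refl refl refl) ⟩
      L.sum (λ L → k L * k L + 6)
        ≡⟨ trans (∑-+ L.elements _ _) (cong₂ _+_ ordered-pairs (sum-const 6)) ⟩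
      1698 ∎))
      where open ≡-Reasoning

    -- The values of k - 2 + τ for k = 1, ..., 6 are 0, 0, 1, 2, 3, 4, so that x₃ + 2x₄ + 3x₅ + 4x₆
    -- = 300 - 266 + 25 = 59. Comparison with the equation for 74 gives the claim.
    x₃+x₄+15 : x 3 + x 4 + 15 ≡ 2 * x 6
    x₃+x₄+15 = +-cancelʳ-≡ 350 _ _ (begin
      x 3 + x 4 + 15 + 350
        ≡⟨ +-assoc (x 3 + x 4) 15 350 ⟩
      x 3 + x 4 + 365
        ≡⟨ cong (x 3 + x 4 +_) (sym (cong₂ _+_ (trans sum-Y x₄+3x₅+6x₆) (cong₂ _+_ tangents (sum-const 2)))) ⟩
      x 3 + x 4 + (L.sum Y + (L.sum τ + L.sum (λ _ → 2)))
        ≡⟨ sym (trans (∑-+ L.elements _ _) (cong₂ _+_ (∑-+ L.elements _ _)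
             (trans (∑-+ L.elements _ _) (cong (L.sum Y +_) (∑-+ L.elements _ _))))) ⟩
      L.sum (λ L → [k≡ 3 ] L + [k≡ 4 ] L + (Y L + (τ L + 2)))
        ≡⟨ ∑-cong L.elements (by-size
             (λ j → 𝟙 (j ≡ᵇ 3) + 𝟙 (j ≡ᵇ 4) + (𝟙 (j ≡ᵇ 4) + (3 * 𝟙 (j ≡ᵇ 5) + 6 * 𝟙 (j ≡ᵇ 6)) + (𝟙 (j ≡ᵇ 1) + 2)))
             (λ j → 2 * 𝟙 (j ≡ᵇ 6) + (j + 2 * 𝟙 (j ≡ᵇ 1))) refl refl refl refl refl refl) ⟩
      L.sum (λ L → 2 * [k≡ 6 ] L + (k L + 2 * τ L))
        ≡⟨ trans (∑-+ L.elements _ _) (cong₂ _+_ (∑-*ˡ L.elements 2 [k≡ 6 ]) (trans (∑-+ L.elements _ _)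
             (cong₂ _+_ incidences (trans (∑-*ˡ L.elements 2 τ) (cong (2 *_) tangents))))) ⟩
      2 * x 6 + 350 ∎)
      where open ≡-Reasoning

    x₄≤1 : x 4 ≤ 1
    x₄≤1 = go (1 ≤? x 4)
      where
      go : Dec (1 ≤ x 4) → x 4 ≤ 1
      go (no x₄≱1) = ≤-trans (≤-pred (≰⇒> x₄≱1)) z≤n
      go (yes 1≤x₄) with ∑-pos L.elements [k≡ 4 ] 1≤x₄
      ... | m , _ , 1≤ = +-cancelʳ-≤ 15 _ 1 (begin
        x 4 + 15         ≤⟨ +-monoˡ-≤ 15 (m≤n+m (x 4) (x 3)) ⟩
        x 3 + x 4 + 15   ≡⟨ x₃+x₄+15 ⟩
        2 * x 6          ≤⟨ *-monoʳ-≤ 2 (#6-secants≤8 (≡ᵇ⇒≡ (k m) 4 (subst T (sym (𝟙-pos _ 1≤)) _))) ⟩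
        16               ∎)
        where open ≤-Reasoning

    impossible : ⊥
    impossible = a+3b+6c≢74 (x 4) (x 5) (x 6) x₄≤1 x₄+3x₅+6x₆

-- The plane over GF(11) in coordinates.

allLines : List Line
allLines =
  concatMap (λ a → map (ln₁ a) (allFin 11)) (allFin 11) ++ (map ln₂ (allFin 11) ++ (ln₃ ∷ []))

∈-allPoints : ∀ P → P ∈ allPoints
∈-allPoints (pt₁ a b) = ∈-++⁺ˡ (∈-concatMap⁺ (λ a → map (pt₁ a) (allFin 11))
  (lose (∈-allFin a) (∈-map⁺ (pt₁ a) (∈-allFin b))))
∈-allPoints (pt₂ a)   = ∈-++⁺ʳ (concatMap (λ a → map (pt₁ a) (allFin 11)) (allFin 11)) (∈-++⁺ˡ (∈-map⁺ pt₂ (∈-allFin a)))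
∈-allPoints pt₃       = ∈-++⁺ʳ (concatMap (λ a → map (pt₁ a) (allFin 11)) (allFin 11)) (∈-++⁺ʳ (map pt₂ (allFin 11)) (here refl))

∈-allLines : ∀ L → L ∈ allLines
∈-allLines (ln₁ a b) = ∈-++⁺ˡ (∈-concatMap⁺ (λ a → map (ln₁ a) (allFin 11))
  (lose (∈-allFin a) (∈-map⁺ (ln₁ a) (∈-allFin b))))
∈-allLines (ln₂ a)   = ∈-++⁺ʳ (concatMap (λ a → map (ln₁ a) (allFin 11)) (allFin 11)) (∈-++⁺ˡ (∈-map⁺ ln₂ (∈-allFin a)))
∈-allLines ln₃       = ∈-++⁺ʳ (concatMap (λ a → map (ln₁ a) (allFin 11)) (allFin 11)) (∈-++⁺ʳ (map ln₂ (allFin 11)) (here refl))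

_≟ᴾ_ : DecidableEquality Point
pt₁ a b ≟ᴾ pt₁ c d = map′ (λ { (refl , refl) → refl }) (λ { refl → refl , refl }) (a Fin.≟ c ×-dec b Fin.≟ d)
pt₁ _ _ ≟ᴾ pt₂ _   = no λ ()
pt₁ _ _ ≟ᴾ pt₃     = no λ ()
pt₂ _   ≟ᴾ pt₁ _ _ = no λ ()
pt₂ a   ≟ᴾ pt₂ b   = map′ (cong pt₂) (λ { refl → refl }) (a Fin.≟ b)
pt₂ _   ≟ᴾ pt₃     = no λ ()
pt₃     ≟ᴾ pt₁ _ _ = no λ ()
pt₃     ≟ᴾ pt₂ _   = no λ ()
pt₃     ≟ᴾ pt₃     = yes refl

_≟ᴸ_ : DecidableEquality Line
ln₁ a b ≟ᴸ ln₁ c d = map′ (λ { (refl , refl) → refl }) (λ { refl → refl , refl }) (a Fin.≟ c ×-dec b Fin.≟ d)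
ln₁ _ _ ≟ᴸ ln₂ _   = no λ ()
ln₁ _ _ ≟ᴸ ln₃     = no λ ()
ln₂ _   ≟ᴸ ln₁ _ _ = no λ ()
ln₂ a   ≟ᴸ ln₂ b   = map′ (cong ln₂) (λ { refl → refl }) (a Fin.≟ b)
ln₂ _   ≟ᴸ ln₃     = no λ ()
ln₃     ≟ᴸ ln₁ _ _ = no λ ()
ln₃     ≟ᴸ ln₂ _   = no λ ()
ln₃     ≟ᴸ ln₃     = yes refl

module _ {A : Set} (_≟_ : DecidableEquality A) (xs : List A) (∈-xs : ∀ x → x ∈ xs) where

  enumeration : All (λ x → ∑ xs (λ y → 𝟙 (does (x ≟ y))) ≡ 1) xs → Enumeration A
  enumeration once = record { _≟′_ = _≟_ ; elements = xs ; once = λ x → All.lookup once (∈-xs x) }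

  -- The sum over ys is taken over the filtered list, so that checking this by
  -- evaluation takes only q + 1 steps for each pair (x , x′).
  Balanced : ∀ {B : Set} (q : ℕ) (ys : List B) (_~_ : A → B → Bool) → Set
  Balanced q ys _~_ = All (λ x → Row (filterᵇ (x ~_) ys) x) xs
    where
    Row : List _ → A → Set
    Row zs x = All (λ x′ → ∑ zs (λ y → 𝟙 (x′ ~ y)) ≡ 1 + q * 𝟙 (does (x ≟ x′))) xs

  balanced? : ∀ {B : Set} q (ys : List B) (_~_ : A → B → Bool) → Dec (Balanced q ys _~_)
  balanced? q ys _~_ = All.all? (λ x → row? (filterᵇ (x ~_) ys) x) xs
    where
    row? : ∀ zs x → Dec (All (λ x′ → ∑ zs (λ y → 𝟙 (x′ ~ y)) ≡ 1 + q * 𝟙 (does (x ≟ x′))) xs)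
    row? zs x = All.all? (λ x′ → ∑ zs (λ y → 𝟙 (x′ ~ y)) Data.Nat.≟ 1 + q * 𝟙 (does (x ≟ x′))) xs

  balanced⇒ : ∀ {B : Set} q (ys : List B) (_~_ : A → B → Bool) → Balanced q ys _~_ →
              ∀ x x′ → ∑ ys (λ y → 𝟙 (x ~ y) * 𝟙 (x′ ~ y)) ≡ 1 + q * 𝟙 (does (x ≟ x′))
  balanced⇒ q ys _~_ bal x x′ = trans (sym (∑-filter (T? ∘ (x ~_)) ys (λ y → 𝟙 (x′ ~ y))))
    (All.lookup (All.lookup bal (∈-xs x)) (∈-xs x′))

pointsE : Enumeration Point
pointsE = enumeration _≟ᴾ_ allPoints ∈-allPoints
  (toWitness {a? = All.all? (λ x → ∑ allPoints (λ y → 𝟙 (does (x ≟ᴾ y))) Data.Nat.≟ 1) allPoints} _)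

linesE : Enumeration Line
linesE = enumeration _≟ᴸ_ allLines ∈-allLines
  (toWitness {a? = All.all? (λ x → ∑ allLines (λ y → 𝟙 (does (x ≟ᴸ y))) Data.Nat.≟ 1) allLines} _)

abstract
  -- The incidence axioms are decided by evaluation on all 133 · 133 pairs.
  join₁₁ : Balanced _≟ᴾ_ allPoints ∈-allPoints 11 allLines incident
  join₁₁ = toWitness {a? = balanced? _≟ᴾ_ allPoints ∈-allPoints 11 allLines incident} _

  meet₁₁ : Balanced _≟ᴸ_ allLines ∈-allLines 11 allPoints (λ L P → incident P L)
  meet₁₁ = toWitness {a? = balanced? _≟ᴸ_ allLines ∈-allLines 11 allPoints (λ L P → incident P L)} _

PG₂[11] : Plane 11
PG₂[11] = record
  { Pt = Point ; Ln = Line ; points = pointsE ; lines = linesE ; _on_ = incident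
  ; join = balanced⇒ _≟ᴾ_ allPoints ∈-allPoints 11 allLines incident join₁₁
  ; meet = balanced⇒ _≟ᴸ_ allLines ∈-allLines 11 allPoints (λ L P → incident P L) meet₁₁ }

-- The polynomial method: blocking all lines but one.

⟨_,_⟩ : Point → Line → ℕ
⟨ P , L ⟩ = let x₀ , x₁ , x₂ = pcoords P
                u₀ , u₁ , u₂ = lcoords L
            in x₀ * u₀ + x₁ * u₁ + x₂ * u₂

incident⇒11∣ : ∀ P L → incident P L ≡ true → 11 ∣ ⟨ P , L ⟩
incident⇒11∣ P L PL = m%n≡0⇒n∣m ⟨ P , L ⟩ 11 (≡ᵇ⇒≡ (⟨ P , L ⟩ % 11) 0 (Equivalence.from T-≡ PL))

11∣⇒incident : ∀ P L → 11 ∣ ⟨ P , L ⟩ → incident P L ≡ true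
11∣⇒incident P L 11∣PL = Equivalence.to T-≡ (≡⇒≡ᵇ (⟨ P , L ⟩ % 11) 0 (n∣m⇒m%n≡0 ⟨ P , L ⟩ 11 11∣PL))

-- Here 0 ^ 0 = 1, as the evaluation of polynomials requires.
monomial : ℕ → ℕ → ℕ → Line → ℕ
monomial i j k L = let u₀ , u₁ , u₂ = lcoords L in u₀ ^ i * u₁ ^ j * u₂ ^ k

-- A polynomial of degree `length B` in the coordinates of the line, divisible by 11 exactly at the
-- lines blocked by `B`.
∏ : List Point → Line → ℕ
∏ B L = product (map (λ P → ⟨ P , L ⟩) B)

∑-∣ : ∀ {A : Set} d xs {f : A → ℕ} → (∀ x → d ∣ f x) → d ∣ ∑ xs f
∑-∣ d []       d∣f = d ∣0
∑-∣ d (x ∷ xs) d∣f = ∣m∣n⇒∣m+n (d∣f x) (∑-∣ d xs d∣f)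

abstract
  -- As 20 is a multiple of 10, the sum over normalised coordinates is minus the
  -- sum over GF(11)³, which vanishes since a monomial of degree 20 < 3 · 10 has an
  -- exponent below 10.  For i + j > 20, where 20 ∸ i ∸ j = 0, the claim still holds.
  power-sum : ∀ i j → i < 21 → j < 21 → 11 ∣ ∑ allLines (monomial i j (20 ∸ i ∸ j))
  power-sum i j i< j< = All.lookup (All.lookup checked (∈-upTo⁺ i<)) (∈-upTo⁺ j<)
    where
    checked : All (λ i → All (λ j → 11 ∣ ∑ allLines (monomial i j (20 ∸ i ∸ j))) (upTo 21)) (upTo 21)
    checked = toWitness
      {a? = All.all? (λ i → All.all? (λ j → 11 ∣? ∑ allLines (monomial i j (20 ∸ i ∸ j))) (upTo 21)) (upTo 21)} _

-- Induction on `B` multiplies out one linear form at a time; the total degree stays 20 until only a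
-- monomial is left, where `power-sum` applies.
∑-form : ∀ B i j k → i + j + k + length B ≡ 20 → 11 ∣ ∑ allLines (λ L → monomial i j k L * ∏ B L)
∑-form [] i j k deg = subst (11 ∣_) (∑-cong allLines λ L → sym (*-identityʳ (monomial i j k L)))
  (subst (λ k → 11 ∣ ∑ allLines (monomial i j k)) {20 ∸ i ∸ j} {k} 20∸i∸j≡k (power-sum i j i<21 j<21))
  where
  deg′ : i + (j + k) ≡ 20
  deg′ = trans (sym (+-assoc i j k)) (trans (sym (+-identityʳ (i + j + k))) deg)
  i<21 : i < 21
  i<21 = s≤s (subst (i ≤_) deg′ (m≤m+n i (j + k)))
  j<21 : j < 21
  j<21 = s≤s (subst (j ≤_) deg′ (≤-trans (m≤m+n j k) (m≤n+m (j + k) i)))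
  20∸i∸j≡k : 20 ∸ i ∸ j ≡ k
  20∸i∸j≡k = trans (cong (λ d → d ∸ i ∸ j) (sym deg′)) (trans (cong (_∸ j) (m+n∸m≡n i (j + k))) (m+n∸m≡n j k))
∑-form (P ∷ B) i j k deg = subst (11 ∣_) (sym expand)
  (∣m∣n⇒∣m+n (∣m∣n⇒∣m+n
    (∣n⇒∣m*n x₀ (∑-form B (suc i) j k shifted))
    (∣n⇒∣m*n x₁ (∑-form B i (suc j) k (trans (cong (λ a → a + k + length B) (+-suc i j)) shifted))))
    (∣n⇒∣m*n x₂ (∑-form B i j (suc k) (trans (cong (_+ length B) (+-suc (i + j) k)) shifted))))
  where
  x₀ = proj₁ (pcoords P)
  x₁ = proj₁ (proj₂ (pcoords P))
  x₂ = proj₂ (proj₂ (pcoords P))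
  shifted : suc (i + j + k + length B) ≡ 20
  shifted = trans (sym (+-suc (i + j + k) (length B))) deg
  distribute : ∀ x y z u v w a b c p →
    a * b * c * ((x * u + y * v + z * w) * p) ≡
    x * (u * a * b * c * p) + y * (a * (v * b) * c * p) + z * (a * b * (w * c) * p)
  distribute = solve 10 (λ x y z u v w a b c p →
    a :* b :* c :* ((x :* u :+ y :* v :+ z :* w) :* p) :=
    x :* (u :* a :* b :* c :* p) :+ y :* (a :* (v :* b) :* c :* p) :+ z :* (a :* b :* (w :* c) :* p)) refl
    where open +-*-Solver
  f₀ f₁ f₂ : Line → ℕ
  f₀ L = monomial (suc i) j k L * ∏ B L
  f₁ L = monomial i (suc j) k L * ∏ B L
  f₂ L = monomial i j (suc k) L * ∏ B L
  expand : ∑ allLines (λ L → monomial i j k L * ∏ (P ∷ B) L) ≡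
           x₀ * ∑ allLines f₀ + x₁ * ∑ allLines f₁ + x₂ * ∑ allLines f₂
  expand = trans
    (∑-cong allLines λ L → let u₀ , u₁ , u₂ = lcoords L in
      distribute x₀ x₁ x₂ u₀ u₁ u₂ (u₀ ^ i) (u₁ ^ j) (u₂ ^ k) (∏ B L))
    (trans (∑-+ allLines (λ L → x₀ * f₀ L + x₁ * f₁ L) (λ L → x₂ * f₂ L)) (cong₂ _+_
      (trans (∑-+ allLines (λ L → x₀ * f₀ L) (λ L → x₁ * f₁ L))
             (cong₂ _+_ (∑-*ˡ allLines x₀ f₀) (∑-*ˡ allLines x₁ f₁)))
      (∑-*ˡ allLines x₂ f₂)))

prime-11 : Prime 11
prime-11 = from-yes (prime? 11)

11∣∏⁺ : ∀ {B} L → Any (λ P → incident P L ≡ true) B → 11 ∣ ∏ B L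
11∣∏⁺ {P ∷ B} L (here PL)  = ∣m⇒∣m*n (∏ B L) (incident⇒11∣ P L PL)
11∣∏⁺ {P ∷ B} L (there BL) = ∣n⇒∣m*n ⟨ P , L ⟩ (11∣∏⁺ L BL)

11∣∏⁻ : ∀ B L → 11 ∣ ∏ B L → Any (λ P → incident P L ≡ true) B
11∣∏⁻ [] L    11∣1 = contradiction 11∣1 (from-no (11 ∣? 1))
11∣∏⁻ (P ∷ B) L 11∣  = [ here ∘ 11∣⇒incident P L , there ∘ 11∣∏⁻ B L ]′ (euclidsLemma ⟨ P , L ⟩ (∏ B L) prime-11 11∣)

-- The sum of `∏ B` over all lines is divisible by 11, and so is every term except possibly that at
-- ℓ; hence that term is too.
20-points-block-last-line : ∀ B ℓ → length B ≡ 20 →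
  (∀ L → L ≢ ℓ → Any (λ P → incident P L ≡ true) B) → Any (λ P → incident P ℓ ≡ true) B
20-points-block-last-line B ℓ |B| blocks = 11∣∏⁻ B ℓ (∣m+n∣m⇒∣n (subst (11 ∣_) split 11∣∑) (∑-∣ 11 allLines 11∣rest))
  where
  open Enumeration linesE using (δ; sum-δ; δ-≢)
  11∣∑ : 11 ∣ ∑ allLines (∏ B)
  11∣∑ = subst (11 ∣_) (∑-cong allLines λ L → *-identityˡ (∏ B L)) (∑-form B 0 0 0 |B|)
  rest : Line → ℕ
  rest L = 𝟙 (not (does (ℓ ≟ᴸ L))) * ∏ B L
  11∣rest : ∀ L → 11 ∣ rest L
  11∣rest L with ℓ ≟ᴸ L
  ... | yes _   = 11 ∣0
  ... | no ℓ≢L = ∣n⇒∣m*n 1 (11∣∏⁺ L (blocks L (ℓ≢L ∘ sym)))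
  split : ∑ allLines (∏ B) ≡ ∑ allLines rest + ∏ B ℓ
  split = trans (∑-cong allLines pointwise) (trans (∑-+ allLines rest (λ L → δ ℓ L * ∏ B L))
    (cong (∑ allLines rest +_) (sum-δ ℓ (∏ B))))
    where
    pointwise : ∀ L → ∏ B L ≡ rest L + δ ℓ L * ∏ B L
    pointwise L with does (ℓ ≟ᴸ L)
    ... | true  = sym (*-identityˡ (∏ B L))
    ... | false = sym (trans (+-identityʳ _) (*-identityˡ (∏ B L)))

-- From the given definitions to the abstract counts.

does-≟-true : ∀ b → does (b Data.Bool.≟ true) ≡ b
does-≟-true true  = refl
does-≟-true false = refl

length-filter-true : ∀ {A : Set} (p : A → Bool) xs →
  length (filter (λ x → p x Data.Bool.≟ true) xs) ≡ ∑ xs (λ x → 𝟙 (p x))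
length-filter-true p xs = trans (length-filter≡∑ (λ x → p x Data.Bool.≟ true) xs)
  (∑-cong xs λ x → cong 𝟙 (does-≟-true (p x)))

module _ (S : PointSet) where
  open Secants PG₂[11] S

  meets≡k : ∀ L → meets S L ≡ k L
  meets≡k L = trans (length-filter-true (λ P → S P ∧ incident P L) allPoints)
                    (∑-cong allPoints λ P → 𝟙-∧ (S P) (incident P L))

  -- By uniqueness the summand of `t P` is the Kronecker delta at the given tangent.
  semioval⇒t≡1 : IsSemioval S → ∀ {P} → S P ≡ true → t P ≡ 1
  semioval⇒t≡1 semi {P} P∈S = trans (∑-cong allLines pointwise) (L.once T₀)
    where
    T₀ : Line
    T₀ = proj₁ (proj₁ (semi P P∈S))
    T₀-tangent : IsTangentAt S P T₀
    T₀-tangent = proj₂ (proj₁ (semi P P∈S))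
    unique : ∀ L → incident P L ≡ true → k L ≡ 1 → T₀ ≡ L
    unique L PL kL = proj₂ (semi P P∈S) T₀ L T₀-tangent (P∈S , PL , trans (meets≡k L) kL)
    pointwise : ∀ L → ι P L * τ L ≡ L.δ T₀ L
    pointwise L = go (T₀ ≟ᴸ L)
      where
      go : (d : Dec (T₀ ≡ L)) → ι P L * τ L ≡ 𝟙 (does d)
      go (yes refl) = cong₂ (λ b j → 𝟙 b * 𝟙 (j ≡ᵇ 1)) (proj₁ (proj₂ T₀-tangent))
                               (trans (sym (meets≡k T₀)) (proj₂ (proj₂ T₀-tangent)))
      go (no T₀≢L)  = n<1⇒n≡0 (≰⇒> λ 1≤ → let PL , τL = *-pos (ι P L) (τ L) 1≤ in
        T₀≢L (unique L (𝟙-pos _ PL) (≡ᵇ⇒≡ (k L) 1 (Equivalence.from T-≡ (𝟙-pos _ τL)))))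

theorem1 : ∀ (S : PointSet) → ¬ (IsBlockingSemioval S × card S ≡ 25)
theorem1 S (((meets≥1 , not-full) , semi) , |S|) =
  -- The `refl` evaluates the number of lines, 11 · 11 + 11 + 1 = 133.
  B.impossible (λ L → [ id , ⊥-elim ∘ not-full L ]′ (k≤q⊎full L)) k≢10 refl
  where
  open Secants PG₂[11] S
  module B = BlockingSemioval25 PG₂[11] S
    (trans (sym (length-filter-true S allPoints)) |S|)
    (λ L → subst (1 ≤_) (meets≡k S L) (meets≥1 L))
    (semioval⇒t≡1 S semi)
  k≢10 : ∀ ℓ → k ℓ ≢ 10
  -- The 20 points lie off ℓ, yet one of them must block ℓ; this step uses the field and not just
  -- the incidence axioms.
  k≢10 ℓ kℓ =
    let B , |B| , off , blocks = B.block-off-10-secant ℓ kℓ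
        P∉ℓ , Pℓ = All.lookupAny off (20-points-block-last-line B ℓ |B| blocks)
    in contradiction (trans (sym Pℓ) P∉ℓ) λ ()
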